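{- There exists an infinite family of Boolean functions $f_n:\{0,1\}^n\to\{0,1\}$ such that $$\mathrm{C}(f_n)\ \ge\ \tilde{\Omega}\left(\mathrm{UC}_{\min}(f_n)^{\frac{\log(38/3)}{\log 8}}\right)\ \ge\ \Omega\left(\mathrm{UC}_{\min}(f_n)^{1.22}\right).$$
   Context: Partial assignments are strings $p\in\{0,1,*\}^n$; $|p|$ is the number of non-$*$ entries; $p\subseteq x$ means $x\in\{0,1\}^n$ agrees with $p$ on all non-$*$ entries; two partial assignments are consistent if they agree wherever neither has $*$. For $f:\{0,1\}^n\to\{0,1\}$ and $b\in\{0,1\}$, $p$ is a $b$-certificate if $f(x)=b$ for all $x\supseteq p$. $\mathrm{C}_x(f)$ is the minimum of $|p|$ over certificates $p\subseteq x$, and $\mathrm{C}(f)=\max_{x\in\{0,1\}^n}\mathrm{C}_x(f)$. An unambiguous collection of $b$-certificates for $f$ is a set $U$ of $b$-certificates such that every $x\in f^{ -1}(b)$ satisfies $p\subseteq x$ for some $p\in U$, and no two distinct elements of $U$ are consistent. $\mathrm{UC}_b(f)$ is the minimum of $\max_{p\in U}|p|$ over such $U$, and $\mathrm{UC}_{\min}(f)=\min\{\mathrm{UC}_0(f),\mathrm{UC}_1(f)\}$. Convention: the family is indexed by an infinite set of $n$, consists of non-constant functions, and $\mathrm{UC}_{\min}(f_n)\to\infty$ along it; $A(f)\ge\tilde\Omega(B(f)^a)$ means that there are constants $c>0,k\ge0$ with $A(f)\ge c\,B(f)^a/(1+\log B(f))^k$ for all $f$ in the family, and $\Omega$ is the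 same with $k=0$. -}

module Defs where

open import Algebra.Definitions.RawSemiring using () renaming (_^_ to pow)
open import Data.Bool using (Bool; true; false)
import Data.Bool.Properties as Bool
open import Data.Integer using (ℤ; +_; -[1+_])
open import Data.List using (List; []; _∷_; _++_; map; filter; cartesianProductWith)
open import Data.List.Extrema.Nat using (min; max)
open import Data.List.Membership.Propositional using (_∈_)
open import Data.List.Membership.Propositional.Properties using (∈-cartesianProductWith⁺)
open import Data.List.Relation.Unary.All as All using (All; all?)
open import Data.List.Relation.Unary.Any using (Any; here; there; any?)
open import Data.Maybe using (Maybe; just; nothing; is-just)
import Data.Maybe.Properties as Maybe
import Data.Maybe.Relation.Unary.All as MAll
open import Data.Nat as ℕ using (ℕ; zero; suc)
open import Data.Product using (∃; ∃₂; ∃-syntax; _×_; _,_)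
open import Data.Rational.Unnormalised
  using (ℚᵘ; mkℚᵘ; ↥_; ↧ₙ_; 0ℚᵘ; 1ℚᵘ; ½; _+_; _*_; _<_; +-*-rawSemiring)
open import Data.Sum using (inj₁; inj₂; [_,_])
open import Data.Vec using (Vec; []; _∷_; countᵇ)
import Data.Vec.Properties as Vec
open import Data.Vec.Relation.Binary.Pointwise.Inductive as Pointwise using (Pointwise)
open import Relation.Binary.PropositionalEquality using (_≡_; _≢_; refl)
open import Relation.Nullary using (¬_; Dec; yes; no; ¬?)
open import Relation.Nullary.Decidable using (map′; _×-dec_; _⊎-dec_; _→-dec_)

------------------------------------------------------------------------
-- Boolean functions and partial assignments

Input : ℕ → Set
Input n = Vec Bool n

BoolFun : ℕ → Set
BoolFun n = Input n → Bool

-- The entry * is `nothing`.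
Partial : ℕ → Set
Partial n = Vec (Maybe Bool) n

size : ∀ {n} → Partial n → ℕ
size = countᵇ is-just

-- `MAll.All P c` holds vacuously for c = nothing.
infix 4 _⊆_
_⊆_ : ∀ {n} → Partial n → Input n → Set
_⊆_ = Pointwise (λ c b → MAll.All (_≡ b) c)

Consistent : ∀ {n} → Partial n → Partial n → Set
Consistent = Pointwise (λ c d → MAll.All (λ a → MAll.All (_≡ a) d) c)

Certificate : ∀ {n} → BoolFun n → Bool → Partial n → Set
Certificate f b p = ∀ x → p ⊆ x → f x ≡ b

-- A list stands for the set of its members.
record UnambiguousCollection {n} (f : BoolFun n) (b : Bool)
                             (U : List (Partial n)) : Set where
  constructor mkUnambiguous
  field
    certificates : All (Certificate f b) U
    covers       : ∀ x → f x ≡ b → Any (_⊆ x) U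
    unambiguous  : ∀ {p q} → p ∈ U → q ∈ U → p ≢ q → ¬ Consistent p q

------------------------------------------------------------------------
-- Finite enumerations and decidability

vectors : ∀ {A : Set} → List A → ∀ n → List (Vec A n)
vectors xs zero    = [] ∷ []
vectors xs (suc n) = cartesianProductWith _∷_ xs (vectors xs n)

∈-vectors : ∀ {A : Set} {xs : List A} → (∀ a → a ∈ xs) →
            ∀ {n} (v : Vec A n) → v ∈ vectors xs n
∈-vectors h []      = here refl
∈-vectors h (a ∷ v) = ∈-cartesianProductWith⁺ _∷_ (h a) (∈-vectors h v)

bools : List Bool
bools = false ∷ true ∷ []

∈-bools : ∀ b → b ∈ bools
∈-bools false = here refl
∈-bools true  = there (here refl)

inputs : ∀ n → List (Input n)
inputs = vectors bools

partials : ∀ n → List (Partial n)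
partials = vectors (nothing ∷ map just bools)

-- All subsets of a duplicate-free list, each listed once.
sublists : ∀ {A : Set} → List A → List (List A)
sublists []       = [] ∷ []
sublists (x ∷ xs) = map (x ∷_) (sublists xs) ++ sublists xs

∀-input? : ∀ {n} {P : Input n → Set} → (∀ x → Dec (P x)) → Dec (∀ x → P x)
∀-input? P? = map′ (λ h x → All.lookup h (∈-vectors ∈-bools x))
                   (λ h → All.tabulate (λ {x} _ → h x))
                   (all? P? (inputs _))

_⊆?_ : ∀ {n} (p : Partial n) (x : Input n) → Dec (p ⊆ x)
_⊆?_ = Pointwise.decidable (λ c b → MAll.dec (Bool._≟ b) c)

consistent? : ∀ {n} (p q : Partial n) → Dec (Consistent p q)
consistent? = Pointwise.decidable (λ c d → MAll.dec (λ a → MAll.dec (Bool._≟ a) d) c)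

_≟ᵖ_ : ∀ {n} (p q : Partial n) → Dec (p ≡ q)
_≟ᵖ_ = Vec.≡-dec (Maybe.≡-dec Bool._≟_)

certificate? : ∀ {n} (f : BoolFun n) b p → Dec (Certificate f b p)
certificate? f b p = ∀-input? (λ x → (p ⊆? x) →-dec (f x Bool.≟ b))

someCertificate? : ∀ {n} (f : BoolFun n) p → Dec (∃[ b ] Certificate f b p)
someCertificate? f p =
  map′ [ (λ h → false , h) , (λ h → true , h) ]
       (λ { (false , h) → inj₁ h ; (true , h) → inj₂ h })
       (certificate? f false p ⊎-dec certificate? f true p)

unambiguousCollection? : ∀ {n} (f : BoolFun n) b U → Dec (UnambiguousCollection f b U)
unambiguousCollection? f b U =
  map′ (λ (h₁ , h₂ , h₃) → mkUnambiguous h₁ h₂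
          (λ p∈ q∈ → All.lookup (All.lookup h₃ p∈) q∈))
       (λ (mkUnambiguous h₁ h₂ h₃) → h₁ , h₂ ,
          All.tabulate (λ p∈ → All.tabulate (λ q∈ → h₃ p∈ q∈)))
       (all? (certificate? f b) U
         ×-dec ∀-input? (λ x → (f x Bool.≟ b) →-dec any? (_⊆? x) U)
         ×-dec all? (λ p → all? (λ q → ¬? (p ≟ᵖ q) →-dec ¬? (consistent? p q)) U) U)

------------------------------------------------------------------------
-- Complexity measures

-- The first argument n of `min` never lowers the minimum below its true
-- value: x itself, viewed as a partial assignment, is a certificate of size n.
C[_] : ∀ {n} → Input n → BoolFun n → ℕ
C[_] {n} x f =
  min n (map size (filter (_⊆? x) (filter (someCertificate? f) (partials n))))

C : ∀ {n} → BoolFun n → ℕ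
C {n} f = max 0 (map (λ x → C[ x ] f) (inputs n))

width : ∀ {n} → List (Partial n) → ℕ
width U = max 0 (map size U)

-- Here too n is harmless: the set of all total assignments in f⁻¹(b) is an
-- unambiguous collection of width at most n.
UC : ∀ {n} → Bool → BoolFun n → ℕ
UC {n} b f =
  min n (map width (filter (unambiguousCollection? f b) (sublists (partials n))))

UCmin : ∀ {n} → BoolFun n → ℕ
UCmin f = UC false f ℕ.⊓ UC true f

-- The infinite index set is given by its increasing enumeration
-- arity 0 < arity 1 < ⋯ .
record Family : Set where
  field
    arity            : ℕ → ℕ
    arity-increasing : ∀ i → arity i ℕ.< arity (suc i)
    fun              : ∀ i → BoolFun (arity i)
    nonConstant      : ∀ i → ∃₂ λ x y → fun i x ≢ fun i y
    UCmin→∞          : ∀ m → ∃[ i₀ ] (∀ i → i₀ ℕ.≤ i → m ℕ.≤ UCmin (fun i))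

------------------------------------------------------------------------
-- Real numbers as two-sided Dedekind cuts of rationals: `Lower x q` means
-- q < x and `Upper x q` means x < q.  No cut axioms are carried; each
-- operation below yields the cut of its real value under the stated
-- conditions on its arguments.

record ℝ : Set₁ where
  field
    Lower Upper : ℚᵘ → Set
open ℝ public

infix 4 _≥ℝ_
_≥ℝ_ : ℝ → ℝ → Set
x ≥ℝ y = ∀ q → Lower y q → Lower x q

fromℚ : ℚᵘ → ℝ
fromℚ r = record { Lower = λ q → q < r ; Upper = λ q → r < q }

fromℕ : ℕ → ℝ
fromℕ m = fromℚ (mkℚᵘ (+ m) 0)

infixl 6 _+ℝ_
_+ℝ_ : ℝ → ℝ → ℝ
x +ℝ y = record
  { Lower = λ q → ∃₂ λ r s → Lower x r × Lower y s × q < r + s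
  ; Upper = λ q → ∃₂ λ r s → Upper x r × Upper y s × r + s < q
  }

-- For x ≥ 0 and y > 0.
infixl 7 _*ℝ_
_*ℝ_ : ℝ → ℝ → ℝ
x *ℝ y = record
  { Lower = λ q → ∃₂ λ r s → Lower x r × Lower y s × 0ℚᵘ < s × q < r * s
  ; Upper = λ q → ∃₂ λ r s → Upper x r × Upper y s × r * s < q
  }

-- For x ≥ 0 and y > 0.
infixl 7 _÷ℝ_
_÷ℝ_ : ℝ → ℝ → ℝ
x ÷ℝ y = record
  { Lower = λ q → ∃₂ λ r s → Lower x r × Upper y s × q * s < r
  ; Upper = λ q → ∃₂ λ r s → Upper x r × Lower y s × 0ℚᵘ < s × r < q * s
  }

-- For x > 0.
infixr 8 _^ℝ_
_^ℝ_ : ℝ → ℕ → ℝ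
x ^ℝ zero  = fromℕ 1
x ^ℝ suc k = x *ℝ x ^ℝ k

infixr 8 _^ℚ_
_^ℚ_ : ℚᵘ → ℕ → ℚᵘ
_^ℚ_ = pow +-*-rawSemiring

2^_ : ℤ → ℚᵘ
2^ (+ m)    = mkℚᵘ (+ 2) 0 ^ℚ m
2^ -[1+ m ] = ½ ^ℚ suc m

-- Logarithm to base 2 of x > 0:  m/d < log₂ x  iff  2^m < x^d.
log₂ : ℚᵘ → ℝ
log₂ x = record
  { Lower = λ q → 2^ (↥ q) < x ^ℚ (↧ₙ q)
  ; Upper = λ q → x ^ℚ (↧ₙ q) < 2^ (↥ q)
  }

-- b to a real power y, for b ≥ 1 and y > 0, through the rational powers
-- b^(m/d) with d = suc e:  q < b^(m/d)  iff  q^d < b^m, for q ≥ 0.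
-- For q < 0 the lower condition holds with m/d = 0/1.
infixr 8 _^^_
_^^_ : ℕ → ℝ → ℝ
b ^^ y = record
  { Lower = λ q → ∃₂ λ m e → Lower y (mkℚᵘ (+ m) e)
                           × q ^ℚ suc e < mkℚᵘ (+ (b ℕ.^ m)) 0
  ; Upper = λ q → ∃₂ λ m e → Upper y (mkℚᵘ (+ m) e)
                           × 0ℚᵘ < q × mkℚᵘ (+ (b ℕ.^ m)) 0 < q ^ℚ suc e
  }

------------------------------------------------------------------------
-- Asymptotic bounds

-- c · B^a / (1 + log B)^k
Ω̃-bound : ℚᵘ → ℕ → ℝ → ℕ → ℝ
Ω̃-bound c k a B =
  (fromℚ c *ℝ B ^^ a) ÷ℝ (fromℕ 1 +ℝ log₂ (mkℚᵘ (+ B) 0)) ^ℝ k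

Ω-bound : ℚᵘ → ℝ → ℕ → ℝ
Ω-bound c = Ω̃-bound c 0

-- log(38/3) / log 8; the base of the logarithm cancels.
exponent : ℝ
exponent = log₂ (mkℚᵘ (+ 38) 2) ÷ℝ log₂ (mkℚᵘ (+ 8) 0)

{-# OPTIONS --safe #-}

-- Let m = 2ˢ.  Take white and black cells (i, j, c) with i and c ranging over m
-- values and j over m².  An A-certificate (i, c) asks for each j that the white
-- cell (i, j, c) be 1 or, for fewer than m values of j, that it be 0 and all
-- black cells (i, j, _) be 1.  A B-certificate (j, c) asks that all white cells
-- (_, j, _) and all black cells (_, j, c) be 0.  Both have size O(m²), and each
-- A-certificate conflicts with each B-certificate.  But if white cells are 0 and
-- black cells are 1, then after fewer than m³ cells are read there still is an
-- A-certificate, and also a B-certificate, consistent with what was read.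
--
-- A cheat sheet turns this partial function into a total one.  Take t = 3s
-- copies, and for every address a ∈ {0,1}ᵗ a sheet that names an A-certificate
-- for each copy ℓ with a_ℓ = 1 and a B-certificate for each copy with a_ℓ = 0;
-- the value is 1 iff the certificates named by some sheet all hold.  A sheet
-- together with its certificates is a 1-certificate of size O(s m²), and these
-- are unambiguous because A conflicts with B.  Reading fewer than m³ = 2ᵗ bits
-- leaves some sheet untouched, hence never certifies the value 0.  So C ≥ m³
-- while UCmin = O(s m²), and 3/2 > log (38/3) / log 8 > 1.22; the slack absorbs
-- the factor s, so k = 0 suffices.

module Submission where

open import Defs
open import Data.Integer using (+_)
open import Data.Nat using (ℕ)
open import Data.Product using (Σ-syntax; ∃-syntax; _×_)
open import Data.Rational.Unnormalised using (ℚᵘ; 0ℚᵘ; _<_; _/_)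

open import Data.Bool using (Bool; true; false; not; if_then_else_)
import Data.Bool.Properties as Bool
open import Data.Empty using (⊥-elim)
open import Data.Fin using (Fin; zero; suc)
import Data.Fin.Properties as Fin
open import Data.Integer as ℤ using (-[1+_])
import Data.Integer.Properties as ℤ
open import Data.List
  using (List; []; _∷_; _++_; map; filter; length; cartesianProduct; cartesianProductWith; concatMap; allFin)
open import Data.List.Properties
  using (length-map; length-++; length-tabulate; concatMap-cong; filter-all; filter-none; filter-reject)
open import Data.List.Extrema.Nat using (v≤min⁺; min≤v⁺; v≤max⁺; max≤v⁺)
import Data.List.Membership.DecPropositional as DecMembership
open import Data.List.Membership.Propositional using (_∈_; _∉_; find; lose)
open import Data.List.Membership.Propositional.Properties
open import Data.List.Relation.Unary.All as All using ([]; _∷_)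
import Data.List.Relation.Unary.All.Properties as All
open import Data.List.Relation.Unary.AllPairs using ([]; _∷_)
open import Data.List.Relation.Unary.Any using (Any; here; there; any?)
open import Data.List.Relation.Unary.Unique.Propositional using (Unique)
import Data.List.Relation.Unary.Unique.Propositional.Properties as Unique
open import Data.Maybe using (just; nothing)
open import Data.Maybe.Properties using (just-injective)
import Data.Maybe.Relation.Unary.All as Maybe
open import Data.Nat as ℕ hiding (_<_; _/_)
open import Data.Nat.Properties
open import Data.Nat.Tactic.RingSolver using (solve-∀)
open import Data.Product using (∃; ∃₂; _,_; proj₁; proj₂)
open import Data.Product.Function.NonDependent.Propositional using (_×-↔_)
import Data.Product.Properties as Product
open import Data.Rational.Unnormalised as ℚ using (mkℚᵘ; ↥_; ↧_; ↧ₙ_; *≤*)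
import Data.Rational.Unnormalised.Properties as ℚ
open import Data.Sum using (inj₁; inj₂)
open import Data.Sum.Function.Propositional using (_⊎-↔_)
open import Data.Vec using (Vec; []; _∷_; lookup; tabulate; replicate)
import Data.Vec as Vec
open import Data.Vec.Properties using (lookup∘tabulate; tabulate∘lookup; tabulate-cong; lookup-replicate)
import Data.Vec.Properties as Vec
open import Data.Vec.Relation.Binary.Pointwise.Inductive as Pointwise using ([]; _∷_)
open import Function using (_∘_; _↔_; mk↔ₛ′; Inverse)
open import Function.Properties.Inverse using (↔-trans; ↔-sym; ↔⇒↣)
open import Relation.Binary.Definitions using (DecidableEquality)
open import Relation.Binary.PropositionalEquality hiding (J)
open import Relation.Nullary using (¬_; Dec; yes; no; contradiction; ¬?; does)
open import Relation.Nullary.Decidable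
  using (_×-dec_; _→-dec_; map′; dec-true; dec-false; via-injection; from-yes)
open import Relation.Unary using (Decidable)

private variable
  X Y : Set
  n N : ℕ

-- Counting and pigeonhole in lists

length-filter-¬ : {P : X → Set} (P? : Decidable P) (xs : List X) →
                  length (filter P? xs) + length (filter (¬? ∘ P?) xs) ≡ length xs
length-filter-¬ P? []       = refl
length-filter-¬ P? (x ∷ xs) with P? x
... | yes _ = cong suc (length-filter-¬ P? xs)
... | no  _ = trans (+-suc _ _) (cong suc (length-filter-¬ P? xs))

module _ (_≟_ : DecidableEquality Y) (g : X → Y) where

  fibre : Y → List X → List X
  fibre y = filter (λ x → g x ≟ y)

  private
    others : Y → List X → List X
    others y = filter (λ x → ¬? (g x ≟ y))

  fibre-others : ∀ {y y′} → y ≢ y′ → ∀ xs → fibre y′ (others y xs) ≡ fibre y′ xs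
  fibre-others ne []       = refl
  fibre-others {y} {y′} ne (x ∷ xs) with g x ≟ y
  ... | yes refl = trans (fibre-others ne xs) (sym (filter-reject (λ x → g x ≟ y′) ne))
  ... | no  _    with g x ≟ y′
  ...   | yes _ = cong (x ∷_) (fibre-others ne xs)
  ...   | no  _ = fibre-others ne xs

  -- Pigeonhole by induction on `ys`: a fibre with at least `M` elements is removed, which leaves
  -- the other fibres intact and few enough elements for the remaining values.
  small-fibre : ∀ M {ys} → Unique ys → ∀ xs → length xs ℕ.< length ys * M →
                ∃[ y ] (y ∈ ys) × length (fibre y xs) ℕ.< M
  small-fibre M {y ∷ ys} (y# ∷ uniq) xs lt with length (fibre y xs) <? M
  ... | yes p = y , here refl , p
  ... | no ¬p with small-fibre M uniq (others y xs)
                     (+-cancelˡ-< M _ _ (≤-<-trans (≤-trans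
                       (+-monoˡ-≤ _ (≮⇒≥ ¬p))
                       (≤-reflexive (length-filter-¬ (λ x → g x ≟ y) xs))) lt))
  ...   | y′ , y′∈ , q = y′ , there y′∈ ,
            subst (λ zs → length zs ℕ.< M) (fibre-others (All.lookup y# y′∈) xs) q

  missed : ∀ {ys} → Unique ys → ∀ xs → length xs ℕ.< length ys →
           ∃[ y ] (∀ {x} → x ∈ xs → g x ≢ y)
  missed uniq xs lt with small-fibre 1 uniq xs (subst (length xs ℕ.<_) (sym (*-identityʳ _)) lt)
  ... | y , _ , q = y , λ {x} x∈ eq → no-member (∈-filter⁺ (λ x → g x ≟ y) x∈ eq) q
    where
    no-member : ∀ {x} {zs : List X} → x ∈ zs → ¬ length zs ℕ.< 1
    no-member (here _)  (s≤s ())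
    no-member (there _) (s≤s ())

remove : {x : X} {ys : List X} → x ∈ ys →
         ∃[ zs ] length ys ≡ suc (length zs) × (∀ {y} → y ∈ ys → y ≢ x → y ∈ zs)
remove {ys = _ ∷ ys} (here refl) =
  ys , refl , λ { (here eq) ne → contradiction eq ne ; (there m) _ → m }
remove {ys = y ∷ _} (there m) with remove m
... | zs , eq , keep = y ∷ zs , cong suc eq ,
      λ { (here e) _ → here e ; (there k) ne → there (keep k ne) }

-- Each element of `xs` uses up one entry of `ys`; by distinctness the later elements survive its
-- removal.
Unique-length-≤ : {xs ys : List X} → Unique xs → (∀ {x} → x ∈ xs → x ∈ ys) → length xs ≤ length ys
Unique-length-≤ []        _   = z≤n
Unique-length-≤ (x# ∷ uniq) sub with remove (sub (here refl))
... | zs , eq , keep = subst (_ ≤_) (sym eq)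
      (s≤s (Unique-length-≤ uniq (λ m → keep (sub (there m)) (λ e → All.lookup x# m (sym e)))))

length-concatMap-≤ : ∀ {B} (h : X → List Y) → (∀ x → length (h x) ≤ B) →
                     ∀ xs → length (concatMap h xs) ≤ length xs * B
length-concatMap-≤ h h≤ []       = z≤n
length-concatMap-≤ h h≤ (x ∷ xs) = ≤-trans (≤-reflexive (length-++ (h x)))
  (+-mono-≤ (h≤ x) (length-concatMap-≤ h h≤ xs))

∈-concatMap : (h : X → List Y) {x : X} {xs : List X} {y : Y} → x ∈ xs → y ∈ h x → y ∈ concatMap h xs
∈-concatMap h x∈ y∈ = ∈-concatMap⁺ h (lose x∈ y∈)

length-cartesianProductWith : {Z : Set} (h : X → Y → Z) (xs : List X) (ys : List Y) →
                              length (cartesianProductWith h xs ys) ≡ length xs * length ys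
length-cartesianProductWith h []       ys = refl
length-cartesianProductWith h (x ∷ xs) ys = trans (length-++ (map (h x) ys))
  (cong₂ _+_ (length-map (h x) ys) (length-cartesianProductWith h xs ys))

-- Lets a collection given by a decidable property compete in the minimum that defines `UC`.
filter∈sublists : {P : X → Set} (P? : Decidable P) (xs : List X) → filter P? xs ∈ sublists xs
filter∈sublists P? []       = here refl
filter∈sublists P? (x ∷ xs) with P? x
... | yes _ = ∈-++⁺ˡ (∈-map⁺ (x ∷_) (filter∈sublists P? xs))
... | no  _ = ∈-++⁺ʳ _ (filter∈sublists P? xs)

-- Supports of partial assignments

support : Partial n → List (Fin n)
support []            = []
support (nothing ∷ p) = map suc (support p)
support (just _ ∷ p)  = zero ∷ map suc (support p)

length-support : (p : Partial n) → length (support p) ≡ size p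
length-support []            = refl
length-support (nothing ∷ p) = trans (length-map suc (support p)) (length-support p)
length-support (just _ ∷ p)  = cong suc (trans (length-map suc (support p)) (length-support p))

∈-support⁺ : (p : Partial n) {k : Fin n} {a : Bool} → lookup p k ≡ just a → k ∈ support p
∈-support⁺ (just _ ∷ p)  {zero}  _  = here refl
∈-support⁺ (just _ ∷ p)  {suc k} eq = there (∈-map⁺ suc (∈-support⁺ p eq))
∈-support⁺ (nothing ∷ p) {suc k} eq = ∈-map⁺ suc (∈-support⁺ p eq)

∈-support⁻ : (p : Partial n) {k : Fin n} → k ∈ support p → ∃[ a ] lookup p k ≡ just a
∈-support⁻ (just a ∷ p) (here refl) = a , refl
∈-support⁻ (just _ ∷ p) (there m) with ∈-map⁻ suc m
... | k , m′ , refl = ∈-support⁻ p m′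
∈-support⁻ (nothing ∷ p) m with ∈-map⁻ suc m
... | k , m′ , refl = ∈-support⁻ p m′

support-unique : (p : Partial n) → Unique (support p)
support-unique []            = []
support-unique (nothing ∷ p) = Unique.map⁺ Fin.suc-injective (support-unique p)
support-unique (just _ ∷ p)  =
  All.map⁺ (All.tabulate (λ _ ())) ∷ Unique.map⁺ Fin.suc-injective (support-unique p)

⊆-lookup : {p : Partial n} {x : Input n} → p ⊆ x →
           ∀ {k a} → lookup p k ≡ just a → a ≡ lookup x k
⊆-lookup p⊆x {k} eq with Pointwise.lookup p⊆x k
... | r rewrite eq = Maybe.drop-just r

lookup-⊆ : {p : Partial n} {x : Input n} →
           (∀ k {a} → lookup p k ≡ just a → a ≡ lookup x k) → p ⊆ x
lookup-⊆ {p = []}          {[]}    _ = []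
lookup-⊆ {p = nothing ∷ p} {_ ∷ x} h = Maybe.nothing ∷ lookup-⊆ (h ∘ suc)
lookup-⊆ {p = just a ∷ p}  {_ ∷ x} h = Maybe.just (h zero refl) ∷ lookup-⊆ (h ∘ suc)

Consistent-lookup : {p q : Partial n} → Consistent p q →
                    ∀ {k a b} → lookup p k ≡ just a → lookup q k ≡ just b → b ≡ a
Consistent-lookup c {k} eq eq′ with Pointwise.lookup c k
... | r rewrite eq | eq′ = Maybe.drop-just (Maybe.drop-just r)

∈-partials : (p : Partial n) → p ∈ partials n
∈-partials = ∈-vectors λ where
  nothing      → here refl
  (just false) → there (here refl)
  (just true)  → there (there (here refl))

-- Bounds on the complexity measures

-- Quantifying over both values `b` gives one notion that bounds `C` and, through the certificate
-- covering `x`, also `UC (f x)`.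
Hard : BoolFun n → Input n → ℕ → Set
Hard f x N = ∀ p b → p ⊆ x → Certificate f b p → N ≤ size p

-- The input `x`, read as a total assignment, is itself a certificate. This handles the default `n`
-- in the minima defining `C[_]` and `UC`.
Hard⇒≤n : {f : BoolFun n} {x : Input n} → Hard f x N → N ≤ n
Hard⇒≤n {n = n} {N = N} {f} {x} hard = subst (N ≤_) (size-total x)
  (hard (Vec.map just x) (f x) (total⊆ x) λ y t → cong f (sym (total⊆⇒≡ x y t)))
  where
  size-total : ∀ {k} (y : Input k) → size (Vec.map just y) ≡ k
  size-total []      = refl
  size-total (_ ∷ y) = cong suc (size-total y)
  total⊆ : ∀ {k} (y : Input k) → Vec.map just y ⊆ y
  total⊆ []      = []
  total⊆ (_ ∷ y) = Maybe.just refl ∷ total⊆ y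
  total⊆⇒≡ : ∀ {k} (y z : Input k) → Vec.map just y ⊆ z → y ≡ z
  total⊆⇒≡ []      []      []                = refl
  total⊆⇒≡ (_ ∷ y) (_ ∷ z) (Maybe.just refl ∷ t) = cong (_ ∷_) (total⊆⇒≡ y z t)

Hard⇒≤C : {f : BoolFun n} {x : Input n} → Hard f x N → N ≤ C f
Hard⇒≤C {n = n} {N} {f} {x} hard =
  v≤max⁺ 0 _ (inj₂ (lose (∈-map⁺ (λ x → C[ x ] f) (∈-vectors ∈-bools x))
    (v≤min⁺ (Hard⇒≤n hard) (All.map⁺ (All.tabulate bound)))))
  where
  bound : ∀ {p} → p ∈ filter (_⊆? x) (filter (someCertificate? f) (partials n)) → N ≤ size p
  bound m with ∈-filter⁻ (_⊆? x) {xs = filter (someCertificate? f) (partials n)} m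
  ... | m′ , p⊆x with ∈-filter⁻ (someCertificate? f) {xs = partials n} m′
  ...   | _ , b , cert = hard _ b p⊆x cert

Hard⇒≤UC : {f : BoolFun n} {x : Input n} → Hard f x N → N ≤ UC (f x) f
Hard⇒≤UC {n = n} {N} {f} {x} hard =
  v≤min⁺ (Hard⇒≤n hard) (All.map⁺ (All.tabulate bound))
  where
  bound : ∀ {U} → U ∈ filter (unambiguousCollection? f (f x)) (sublists (partials n)) → N ≤ width U
  bound {U} m with ∈-filter⁻ (unambiguousCollection? f (f x)) {xs = sublists (partials n)} m
  ... | _ , mkUnambiguous certs covers _ with find (covers x refl)
  ...   | p , p∈U , p⊆x = v≤max⁺ 0 _ (inj₂ (lose (∈-map⁺ size p∈U)
                            (hard p (f x) p⊆x (All.lookup certs p∈U))))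

-- The collection is the image of f⁻¹(b) under `cert`. It is cut out of `partials n` by the
-- decidable property `Good`, so equal certificates of different inputs merge into one member.
UC≤ : {f : BoolFun n} {b : Bool} (cert : Input n → Partial n) →
      (∀ x → cert x ⊆ x) →
      (∀ x → f x ≡ b → Certificate f b (cert x)) →
      (∀ x y → f x ≡ b → f y ≡ b → Consistent (cert x) (cert y) → cert x ≡ cert y) →
      (∀ x → f x ≡ b → size (cert x) ≤ N) →
      UC b f ≤ N
UC≤ {n = n} {N} {f} {b} cert cert⊆ certifies unamb size≤ =
  min≤v⁺ n _ (inj₂ (lose (∈-map⁺ width (∈-filter⁺ (unambiguousCollection? f b)
      (filter∈sublists good? (partials n))
      (mkUnambiguous
        (All.tabulate certs)
        (λ x fx → lose (∈-filter⁺ good? (∈-partials (cert x))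
                          (lose (∈-vectors ∈-bools x) (fx , refl))) (cert⊆ x))
        pairs)))
    (max≤v⁺ z≤n (All.map⁺ (All.tabulate sizes)))))
  where
  Good : Partial n → Set
  Good p = Any (λ x → f x ≡ b × cert x ≡ p) (inputs n)
  good? : Decidable Good
  good? p = any? (λ x → (f x Bool.≟ b) ×-dec (cert x ≟ᵖ p)) (inputs n)
  U = filter good? (partials n)
  origin : ∀ {p} → p ∈ U → ∃[ x ] f x ≡ b × cert x ≡ p
  origin m with find (proj₂ (∈-filter⁻ good? {xs = partials n} m))
  ... | x , _ , h = x , h
  certs : ∀ {p} → p ∈ U → Certificate f b p
  certs m with origin m
  ... | x , fx , refl = certifies x fx
  pairs : ∀ {p q} → p ∈ U → q ∈ U → p ≢ q → ¬ Consistent p q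
  pairs p∈ q∈ p≢q con with origin p∈ | origin q∈
  ... | x , fx , refl | y , fy , refl = p≢q (unamb x y fx fy con)
  sizes : ∀ {p} → p ∈ U → size p ≤ N
  sizes m with origin m
  ... | x , fx , refl = size≤ x fx

-- Inputs indexed by a finite type

module Indexed {X : Set} {n} (X↔Fin : X ↔ Fin n) where
  open Inverse X↔Fin using (to; from; strictlyInverseˡ; strictlyInverseʳ)

  infix 4 _≟ˣ_
  abstract
    _≟ˣ_ : DecidableEquality X
    _≟ˣ_ = via-injection (↔⇒↣ X↔Fin) Fin._≟_

  open DecMembership _≟ˣ_ public using (_∈?_)

  ⟦_⟧ : Input n → X → Bool
  ⟦ v ⟧ x = lookup v (to x)

  vec : (X → Bool) → Input n
  vec z = tabulate (z ∘ from)

  ⟦vec⟧ : ∀ z x → ⟦ vec z ⟧ x ≡ z x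
  ⟦vec⟧ z x = trans (lookup∘tabulate (z ∘ from) (to x)) (cong z (strictlyInverseʳ x))

  -- Adversary argument: a certificate of size below `N` fixes only the positions `l` of its
  -- support, so it also lies in `vec z′`, where `f` has the other value.
  hard : {f : BoolFun n} {z : X → Bool} →
         (∀ l → length l ℕ.< N → ∃[ z′ ] (∀ {x} → x ∈ l → z′ x ≡ z x) × f (vec z′) ≢ f (vec z)) →
         Hard f (vec z) N
  hard {f = f} {z} h p b p⊆z cert = ≮⇒≥ λ size<N →
    let l = map from (support p)
        z′ , agree , differ = h l (subst (ℕ._< _)
          (sym (trans (length-map from (support p)) (length-support p))) size<N)
        p⊆z′ = lookup-⊆ λ k eq → trans (⊆-lookup p⊆z eq) (trans (lookup∘tabulate _ k)
                 (trans (sym (agree (∈-map⁺ from (∈-support⁺ p eq)))) (sym (lookup∘tabulate _ k))))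
    in differ (trans (cert (vec z′) p⊆z′) (sym (cert (vec z) p⊆z)))

  restrict : Input n → List X → Partial n
  restrict v l = tabulate λ k → if does (from k ∈? l) then just (lookup v k) else nothing

  private
    lookup-restrict : ∀ v l k → lookup (restrict v l) k ≡ (if does (from k ∈? l) then just (lookup v k) else nothing)
    lookup-restrict v l = lookup∘tabulate _

  restrict-just⁺ : ∀ v {l x} → x ∈ l → lookup (restrict v l) (to x) ≡ just (⟦ v ⟧ x)
  restrict-just⁺ v {l} {x} x∈l = trans (lookup-restrict v l (to x))
    (cong (if_then just (⟦ v ⟧ x) else nothing)
      (dec-true (from (to x) ∈? l) (subst (_∈ l) (sym (strictlyInverseʳ x)) x∈l)))

  restrict-just⁻ : ∀ v l k {a} → lookup (restrict v l) k ≡ just a → from k ∈ l × a ≡ lookup v k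
  restrict-just⁻ v l k eq with from k ∈? l | trans (sym (lookup-restrict v l k)) eq
  ... | yes m | eq′ = m , sym (just-injective eq′)
  ... | no  _ | ()

  restrict-⊆ : ∀ v l → restrict v l ⊆ v
  restrict-⊆ v l = lookup-⊆ λ k eq → proj₂ (restrict-just⁻ v l k eq)

  restrict-⊆⇒agree : ∀ v {w l} → restrict v l ⊆ w → ∀ {x} → x ∈ l → ⟦ v ⟧ x ≡ ⟦ w ⟧ x
  restrict-⊆⇒agree v p⊆w x∈l = ⊆-lookup p⊆w (restrict-just⁺ v x∈l)

  Consistent⇒agree : ∀ v w {l l′} → Consistent (restrict v l) (restrict w l′) →
                     ∀ {x} → x ∈ l → x ∈ l′ → ⟦ v ⟧ x ≡ ⟦ w ⟧ x
  Consistent⇒agree v w c x∈l x∈l′ =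
    sym (Consistent-lookup c (restrict-just⁺ v x∈l) (restrict-just⁺ w x∈l′))

  agree⇒restrict≡ : ∀ v w {l} → (∀ {x} → x ∈ l → ⟦ v ⟧ x ≡ ⟦ w ⟧ x) → restrict v l ≡ restrict w l
  agree⇒restrict≡ v w {l} agree = tabulate-cong pointwise
    where
    pointwise : ∀ k → (if does (from k ∈? l) then just (lookup v k) else nothing)
                    ≡ (if does (from k ∈? l) then just (lookup w k) else nothing)
    pointwise k with from k ∈? l
    ... | yes m = cong just (subst (λ i → lookup v i ≡ lookup w i) (strictlyInverseˡ k) (agree m))
    ... | no  _ = refl

  -- Only an inequality, since `l` may repeat positions while the support does not.
  size-restrict : ∀ v l → size (restrict v l) ≤ length l
  size-restrict v l = subst₂ _≤_ (length-support (restrict v l)) (length-map to l)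
    (Unique-length-≤ (support-unique (restrict v l)) λ {k} k∈ →
      let _ , eq = ∈-support⁻ (restrict v l) k∈
      in subst (_∈ map to l) (strictlyInverseˡ k) (∈-map⁺ to (proj₁ (restrict-just⁻ v l k eq))))

-- Bit vectors and exhaustive search

Vec↔Fin : ∀ k → Vec Bool k ↔ Fin (2 ^ k)
Vec↔Fin zero    = mk↔ₛ′ (λ _ → zero) (λ _ → []) (λ { zero → refl }) (λ { [] → refl })
Vec↔Fin (suc k) = ↔-trans uncons (↔-trans (↔-sym Fin.2↔Bool ×-↔ Vec↔Fin k) (↔-sym Fin.*↔×))
  where
  uncons : Vec Bool (suc k) ↔ (Bool × Vec Bool k)
  uncons = mk↔ₛ′ (λ { (b ∷ v) → b , v }) (λ (b , v) → b ∷ v) (λ _ → refl) (λ { (_ ∷ _) → refl })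

inputs-unique : ∀ k → Unique (inputs k)
inputs-unique zero    = [] ∷ []
inputs-unique (suc k) = Unique.cartesianProductWith⁺ _∷_ (λ { refl → refl , refl })
  (((λ ()) ∷ []) ∷ ([] ∷ [])) (inputs-unique k)

length-inputs : ∀ k → length (inputs k) ≡ 2 ^ k
length-inputs zero    = refl
length-inputs (suc k) = trans (length-cartesianProductWith _∷_ bools (inputs k)) (cong (2 *_) (length-inputs k))

choose : {A : Set} {P : A → Set} → A → Dec (∃ P) → A
choose _ (yes (a , _)) = a
choose a (no _)        = a

choose-correct : {A : Set} {P : A → Set} (a : A) (P? : Dec (∃ P)) → does P? ≡ true → P (choose a P?)
choose-correct a (yes (_ , p)) _ = p

∃-input? : ∀ {n} {P : Input n → Set} → Decidable P → Dec (∃ P)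
∃-input? P? = map′ (λ h → let x , _ , p = find h in x , p)
                   (λ (x , p) → lose (∈-vectors ∈-bools x) p)
                   (any? P? (inputs _))

-- The cheat-sheet function

-- The colour of a cell doubles as its value in `blank`, the input on which certificates are large.
pattern white = false
pattern black = true

module Construction (s : ℕ) where

  Q : Set
  Q = Input s

  m t : ℕ
  m = 2 ^ s
  t = 3 * s

  Address : Set
  Address = Input t

  -- The sheet at address a holds three names of elements of Q per copy.  They are
  -- i and c (the third is ignored) for A, and the halves of j and c for B.
  data Pos : Set where
    cell  : Fin t → Bool → Q → Q × Q → Q → Pos
    sheet : Address → Fin t → Fin 3 → Fin s → Pos

  arity : ℕ
  arity = t * (2 * (m * ((m * m) * m))) + 2 ^ t * (t * (3 * s))

  Pos↔Fin : Pos ↔ Fin arity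
  Pos↔Fin = ↔-trans (mk↔ₛ′
      (λ { (cell ℓ b i j c) → inj₁ (ℓ , b , i , j , c) ; (sheet a ℓ f b) → inj₂ (a , ℓ , f , b) })
      (λ { (inj₁ (ℓ , b , i , j , c)) → cell ℓ b i j c ; (inj₂ (a , ℓ , f , b)) → sheet a ℓ f b })
      (λ { (inj₁ _) → refl ; (inj₂ _) → refl })
      (λ { (cell _ _ _ _ _) → refl ; (sheet _ _ _ _) → refl }))
    (↔-trans
      ((fin ⊗ (↔-sym Fin.2↔Bool ⊗ (Vec↔Fin s ⊗ ((Vec↔Fin s ⊗ Vec↔Fin s) ⊗ Vec↔Fin s))))
        ⊎-↔ (Vec↔Fin t ⊗ (fin ⊗ (fin ⊗ fin))))
      (↔-sym Fin.+↔⊎))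
    where
    fin : ∀ {k} → Fin k ↔ Fin k
    fin = mk↔ₛ′ (λ k → k) (λ k → k) (λ _ → refl) (λ _ → refl)
    _⊗_ : ∀ {A B : Set} {k l} → A ↔ Fin k → B ↔ Fin l → (A × B) ↔ Fin (k * l)
    e ⊗ e′ = ↔-trans (e ×-↔ e′) (↔-sym Fin.*↔×)

  open Indexed Pos↔Fin

  Assignment : Set
  Assignment = Pos → Bool

  component′ : Assignment → Address → Fin t → Fin 3 → Q
  component′ z a ℓ f = tabulate λ b → z (sheet a ℓ f b)

  pointer : Assignment → Address → Fin t → Q × Q × Q
  pointer z a ℓ = component′ z a ℓ zero , component′ z a ℓ (suc zero) , component′ z a ℓ (suc (suc zero))

  J : List (Q × Q)
  J = cartesianProduct (inputs s) (inputs s)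

  ∈-J : ∀ j → j ∈ J
  ∈-J (j₁ , j₂) = ∈-cartesianProduct⁺ (∈-vectors ∈-bools j₁) (∈-vectors ∈-bools j₂)

  -- The rows in which the A-certificate (i, c) finds a white 0 and has to fall back on black cells.
  slack : Assignment → Fin t → Q → Q → List (Q × Q)
  slack z ℓ i c = filter (λ j → z (cell ℓ white i j c) Bool.≟ false) J

  ValidAt : Assignment → Fin t → Bool → Q × Q × Q → Set
  ValidAt z ℓ true (i , c , _) =
    length (slack z ℓ i c) ℕ.< m ×
    (∀ j₁ j₂ c′ → z (cell ℓ white i (j₁ , j₂) c) ≡ false → z (cell ℓ black i (j₁ , j₂) c′) ≡ true)
  ValidAt z ℓ false (j₁ , j₂ , c) =
    (∀ i c′ → z (cell ℓ white i (j₁ , j₂) c′) ≡ false) ×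
    (∀ i → z (cell ℓ black i (j₁ , j₂) c) ≡ false)

  Valid : Assignment → Address → Set
  Valid z a = ∀ ℓ → ValidAt z ℓ (lookup a ℓ) (pointer z a ℓ)

  validAt? : ∀ z ℓ b q → Dec (ValidAt z ℓ b q)
  validAt? z ℓ true (i , c , _) = (_ <? _) ×-dec
    ∀-input? λ j₁ → ∀-input? λ j₂ → ∀-input? λ c′ → (_ Bool.≟ _) →-dec (_ Bool.≟ _)
  validAt? z ℓ false (j₁ , j₂ , c) =
    (∀-input? λ i → ∀-input? λ c′ → _ Bool.≟ _) ×-dec (∀-input? λ i → _ Bool.≟ _)

  valid? : ∀ z → Dec (∃ (Valid z))
  valid? z = ∃-input? λ a → Fin.all? λ ℓ → validAt? z ℓ (lookup a ℓ) (pointer z a ℓ)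

  f : BoolFun arity
  f v = does (valid? ⟦ v ⟧)

  -- Positions read by a sheet and its certificates

  sheetReads : Address → List Pos
  sheetReads a = concatMap (λ ℓ → cartesianProductWith (sheet a ℓ) (allFin 3) (allFin s)) (allFin t)

  gapReads : Fin t → Q → Q → Q → Q → List Pos
  gapReads ℓ j₁ j₂ c i = cell ℓ black i (j₁ , j₂) c ∷ map (cell ℓ white i (j₁ , j₂)) (inputs s)

  -- An A-certificate reads black cells only in its slack rows; this keeps it at O(m²) positions and
  -- makes the list depend on `z`.
  cellReads : Assignment → Fin t → Bool → Q × Q × Q → List Pos
  cellReads z ℓ true (i , c , _) =
    map (λ j → cell ℓ white i j c) J ++
    concatMap (λ j → map (cell ℓ black i j) (inputs s)) (slack z ℓ i c)
  cellReads z ℓ false (j₁ , j₂ , c) =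
    concatMap (gapReads ℓ j₁ j₂ c) (inputs s)

  reads : Assignment → Address → List Pos
  reads z a = sheetReads a ++ concatMap (λ ℓ → cellReads z ℓ (lookup a ℓ) (pointer z a ℓ)) (allFin t)

  ∈-sheetReads : ∀ z a ℓ i b → sheet a ℓ i b ∈ reads z a
  ∈-sheetReads z a ℓ i b = ∈-++⁺ˡ
    (∈-concatMap _ (∈-allFin ℓ) (∈-cartesianProductWith⁺ (sheet a ℓ) (∈-allFin i) (∈-allFin b)))

  ∈-cellReads : ∀ z a ℓ {x} → x ∈ cellReads z ℓ (lookup a ℓ) (pointer z a ℓ) → x ∈ reads z a
  ∈-cellReads z a ℓ x∈ = ∈-++⁺ʳ (sheetReads a)
    (∈-concatMap (λ ℓ → cellReads z ℓ (lookup a ℓ) (pointer z a ℓ)) (∈-allFin ℓ) x∈)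

  white∈A : ∀ z ℓ (q@(i , c , _) : Q × Q × Q) j → cell ℓ white i j c ∈ cellReads z ℓ true q
  white∈A z ℓ _ j = ∈-++⁺ˡ (∈-map⁺ _ (∈-J j))

  black∈A : ∀ z ℓ (q@(i , c , _) : Q × Q × Q) j c′ → z (cell ℓ white i j c) ≡ false →
            cell ℓ black i j c′ ∈ cellReads z ℓ true q
  black∈A z ℓ (i , _) j c′ eq = ∈-++⁺ʳ _ (∈-concatMap (λ j → map (cell ℓ black i j) (inputs s))
    (∈-filter⁺ _ (∈-J j) eq) (∈-map⁺ _ (∈-vectors ∈-bools c′)))

  white∈B : ∀ z ℓ (q@(j₁ , j₂ , _) : Q × Q × Q) i c′ → cell ℓ white i (j₁ , j₂) c′ ∈ cellReads z ℓ false q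
  white∈B z ℓ (j₁ , j₂ , c) i c′ =
    ∈-concatMap (gapReads ℓ j₁ j₂ c) (∈-vectors ∈-bools i) (there (∈-map⁺ _ (∈-vectors ∈-bools c′)))

  black∈B : ∀ z ℓ (q@(j₁ , j₂ , c) : Q × Q × Q) i → cell ℓ black i (j₁ , j₂) c ∈ cellReads z ℓ false q
  black∈B z ℓ (j₁ , j₂ , c) i = ∈-concatMap (gapReads ℓ j₁ j₂ c) (∈-vectors ∈-bools i) (here refl)

  filter-agree : {X : Set} (g h : X → Bool) (xs : List X) → (∀ x → g x ≡ h x) →
                 filter (λ x → g x Bool.≟ false) xs ≡ filter (λ x → h x Bool.≟ false) xs
  filter-agree g h []       eq = refl
  filter-agree g h (x ∷ xs) eq with g x | h x | eq x
  ... | true  | _ | refl = filter-agree g h xs eq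
  ... | false | _ | refl = cong (x ∷_) (filter-agree g h xs eq)

  slack-cong : ∀ z z′ ℓ i c → (∀ j → z (cell ℓ white i j c) ≡ z′ (cell ℓ white i j c)) →
               slack z ℓ i c ≡ slack z′ ℓ i c
  slack-cong z z′ ℓ i c = filter-agree _ _ J

  -- Agreement is assumed only on shared positions, which is all that consistency of two
  -- certificates supplies. The white cells of (i, c) are always shared, and they determine the
  -- slack.
  cellReads-cong : ∀ z z′ ℓ b q →
    (∀ {x} → x ∈ cellReads z ℓ b q → x ∈ cellReads z′ ℓ b q → z x ≡ z′ x) →
    cellReads z ℓ b q ≡ cellReads z′ ℓ b q
  cellReads-cong z z′ ℓ true q@(i , c , _) agree =
    cong (λ xs → map (λ j → cell ℓ white i j c) J ++ concatMap (λ j → map (cell ℓ black i j) (inputs s)) xs)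
         (slack-cong z z′ ℓ i c λ j → agree (white∈A z ℓ q j) (white∈A z′ ℓ q j))
  cellReads-cong z z′ ℓ false q agree = refl

  pointer-cong : ∀ z z′ a → (∀ {x} → x ∈ reads z a → x ∈ reads z′ a → z x ≡ z′ x) →
                 ∀ ℓ → pointer z a ℓ ≡ pointer z′ a ℓ
  pointer-cong z z′ a agree ℓ = cong₂ _,_ (part zero) (cong₂ _,_ (part (suc zero)) (part (suc (suc zero))))
    where
    part : ∀ i → component′ z a ℓ i ≡ component′ z′ a ℓ i
    part i = tabulate-cong λ b → agree (∈-sheetReads z a ℓ i b) (∈-sheetReads z′ a ℓ i b)

  reads-cong : ∀ z z′ a → (∀ {x} → x ∈ reads z a → x ∈ reads z′ a → z x ≡ z′ x) → reads z a ≡ reads z′ a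
  reads-cong z z′ a agree = cong (sheetReads a ++_) (concatMap-cong same (allFin t))
    where
    same : ∀ ℓ → cellReads z ℓ (lookup a ℓ) (pointer z a ℓ) ≡ cellReads z′ ℓ (lookup a ℓ) (pointer z′ a ℓ)
    same ℓ = trans
      (cellReads-cong z z′ ℓ (lookup a ℓ) (pointer z a ℓ) λ x∈ x∈′ → agree (∈-cellReads z a ℓ x∈)
        (∈-cellReads z′ a ℓ (subst (λ q → _ ∈ cellReads z′ ℓ (lookup a ℓ) q) ptr≡ x∈′)))
      (cong (cellReads z′ ℓ (lookup a ℓ)) ptr≡)
      where ptr≡ = pointer-cong z z′ a agree ℓ

  ValidAt-resp : ∀ z z′ ℓ b q → (∀ {x} → x ∈ cellReads z ℓ b q → z x ≡ z′ x) →
                 ValidAt z ℓ b q → ValidAt z′ ℓ b q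
  ValidAt-resp z z′ ℓ true q@(i , c , _) agree (short , blacks) =
    subst (λ xs → length xs ℕ.< m) (slack-cong z z′ ℓ i c whites) short ,
    -- A white 0 of `z′` is also one of `z`, so the black cells in its row are among those read.
    λ j₁ j₂ c′ w → let w′ = trans (whites (j₁ , j₂)) w in
      trans (sym (agree (black∈A z ℓ q (j₁ , j₂) c′ w′))) (blacks j₁ j₂ c′ w′)
    where
    whites : ∀ j → z (cell ℓ white i j c) ≡ z′ (cell ℓ white i j c)
    whites j = agree (white∈A z ℓ q j)
  ValidAt-resp z z′ ℓ false q agree (whites , blacks) =
    (λ i c′ → trans (sym (agree (white∈B z ℓ q i c′))) (whites i c′)) ,
    (λ i → trans (sym (agree (black∈B z ℓ q i))) (blacks i))

  Valid-resp : ∀ z z′ a → (∀ {x} → x ∈ reads z a → z x ≡ z′ x) → Valid z a → Valid z′ a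
  Valid-resp z z′ a agree valid ℓ = subst (ValidAt z′ ℓ (lookup a ℓ))
    (pointer-cong z z′ a (λ x∈ _ → agree x∈) ℓ)
    (ValidAt-resp z z′ ℓ _ _ (λ x∈ → agree (∈-cellReads z a ℓ x∈)) (valid ℓ))

  -- Unambiguity

  A-conflicts-B : ∀ z z′ ℓ q q′ → ValidAt z ℓ true q → ValidAt z′ ℓ false q′ →
    ¬ (∀ {x} → x ∈ cellReads z ℓ true q → x ∈ cellReads z′ ℓ false q′ → z x ≡ z′ x)
  A-conflicts-B z z′ ℓ q@(i , c , _) q′@(j₁ , j₂ , c′) (_ , blacks) (whites′ , blacks′) agree =
    -- Both read the white cell (i, j, c). As B makes it 0, A needs the black cell (i, j, c′) to be
    -- 1, whereas B reads it as 0.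
    contradiction (trans (sym (blacks j₁ j₂ c′ w))
      (trans (agree (black∈A z ℓ q _ c′ w) (black∈B z′ ℓ q′ i)) (blacks′ i))) λ ()
    where
    w : z (cell ℓ white i (j₁ , j₂) c) ≡ false
    w = trans (agree (white∈A z ℓ q _) (white∈B z′ ℓ q′ i c)) (whites′ i c)

  ValidAt-same-bit : ∀ z z′ ℓ b b′ q q′ → ValidAt z ℓ b q → ValidAt z′ ℓ b′ q′ →
    (∀ {x} → x ∈ cellReads z ℓ b q → x ∈ cellReads z′ ℓ b′ q′ → z x ≡ z′ x) → b ≡ b′
  ValidAt-same-bit z z′ ℓ true  true  q q′ v v′ agree = refl
  ValidAt-same-bit z z′ ℓ false false q q′ v v′ agree = refl
  ValidAt-same-bit z z′ ℓ true  false q q′ v v′ agree = ⊥-elim (A-conflicts-B z z′ ℓ q q′ v v′ agree)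
  ValidAt-same-bit z z′ ℓ false true  q q′ v v′ agree =
    ⊥-elim (A-conflicts-B z′ z ℓ q′ q v′ v λ x∈ x∈′ → sym (agree x∈′ x∈))

  -- All sheets refer to the same cells, so in every copy the bits of the two addresses can be
  -- compared through the cells alone.
  same-address : ∀ z z′ a a′ → Valid z a → Valid z′ a′ →
                 (∀ {x} → x ∈ reads z a → x ∈ reads z′ a′ → z x ≡ z′ x) → a ≡ a′
  same-address z z′ a a′ v v′ agree = trans (sym (tabulate∘lookup a))
    (trans (tabulate-cong λ ℓ → ValidAt-same-bit z z′ ℓ _ _ _ _ (v ℓ) (v′ ℓ)
              λ x∈ x∈′ → agree (∈-cellReads z a ℓ x∈) (∈-cellReads z′ a′ ℓ x∈′))
           (tabulate∘lookup a′))

  -- Size of the 1-certificates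

  length-J : length J ≡ m * m
  length-J = trans (length-cartesianProductWith _,_ (inputs s) (inputs s))
    (cong₂ _*_ (length-inputs s) (length-inputs s))

  length-cellReads : ∀ z ℓ b q → ValidAt z ℓ b q → length (cellReads z ℓ b q) ≤ m * m + m * m
  length-cellReads z ℓ true (i , c , _) (short , _) = ≤-trans
    (≤-reflexive (length-++ (map (λ j → cell ℓ white i j c) J)))
    (+-mono-≤ (≤-reflexive (trans (length-map _ J) length-J))
      (≤-trans (length-concatMap-≤ _ (λ j → ≤-reflexive (trans (length-map _ (inputs s)) (length-inputs s)))
                  (slack z ℓ i c))
               (*-monoˡ-≤ m (<⇒≤ short))))
  length-cellReads z ℓ false (j₁ , j₂ , c) _ = ≤-trans
    (length-concatMap-≤ _
      (λ i → ≤-reflexive (cong suc (trans (length-map _ (inputs s)) (length-inputs s)))) (inputs s))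
    (≤-trans (≤-reflexive (trans (cong (_* suc m) (length-inputs s)) (*-suc m m)))
             -- A B-certificate reads m groups of m + 1 cells, and m + m² ≤ 2m².
             (+-monoˡ-≤ (m * m) (m≤m*n m m {{m^n≢0 2 s}})))

  length-reads : ∀ z a → Valid z a → length (reads z a) ≤ t * (3 * s) + t * (m * m + m * m)
  length-reads z a valid = ≤-trans (≤-reflexive (length-++ (sheetReads a))) (+-mono-≤
    (≤-trans (length-concatMap-≤ _ (λ ℓ → ≤-reflexive (length-sheet ℓ)) (allFin t))
             (≤-reflexive (cong (_* (3 * s)) (length-allFin t))))
    (≤-trans (length-concatMap-≤ _ (λ ℓ → length-cellReads z ℓ (lookup a ℓ) (pointer z a ℓ) (valid ℓ)) (allFin t))
             (≤-reflexive (cong (_* (m * m + m * m)) (length-allFin t)))))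
    where
    length-allFin : ∀ k → length (allFin k) ≡ k
    length-allFin k = length-tabulate {n = k} (λ i → i)
    length-sheet : ∀ ℓ → length (cartesianProductWith (sheet a ℓ) (allFin 3) (allFin s)) ≡ 3 * s
    length-sheet ℓ = trans (length-cartesianProductWith (sheet a ℓ) (allFin 3) (allFin s))
                           (cong (3 *_) (length-allFin s))

  -- The certificate of `v` is `v` on the positions read at a valid address. Consistency of two of
  -- them forces in turn equal addresses, equal lists of positions and equal values.
  UC₁≤ : UC true f ≤ t * (3 * s) + t * (m * m + m * m)
  UC₁≤ = UC≤ cert (λ v → restrict-⊆ v (readsOf v))
    (λ v fv w p⊆w → dec-true (valid? ⟦ w ⟧)
      (address v , Valid-resp ⟦ v ⟧ ⟦ w ⟧ (address v) (restrict-⊆⇒agree v p⊆w) (address-valid v fv)))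
    unamb
    (λ v fv → ≤-trans (size-restrict v (readsOf v)) (length-reads ⟦ v ⟧ (address v) (address-valid v fv)))
    where
    address : Input arity → Address
    -- The default occurs only when `f v` is false; the certificate then merely has to lie in `v`.
    address v = choose (replicate t false) (valid? ⟦ v ⟧)
    address-valid : ∀ v → f v ≡ true → Valid ⟦ v ⟧ (address v)
    address-valid v = choose-correct (replicate t false) (valid? ⟦ v ⟧)
    readsOf : Input arity → List Pos
    readsOf v = reads ⟦ v ⟧ (address v)
    cert : Input arity → Partial arity
    cert v = restrict v (readsOf v)
    unamb : ∀ v w → f v ≡ true → f w ≡ true → Consistent (cert v) (cert w) → cert v ≡ cert w
    unamb v w fv fw con = trans (agree⇒restrict≡ v w λ {x} x∈ → agree x∈ (subst (x ∈_) same-reads x∈))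
                                (cong (restrict w) same-reads)
      where
      agree : ∀ {x} → x ∈ readsOf v → x ∈ readsOf w → ⟦ v ⟧ x ≡ ⟦ w ⟧ x
      agree = Consistent⇒agree v w con
      same : address v ≡ address w
      same = same-address ⟦ v ⟧ ⟦ w ⟧ _ _ (address-valid v fv) (address-valid w fw) agree
      same-reads : readsOf v ≡ readsOf w
      same-reads = trans (reads-cong ⟦ v ⟧ ⟦ w ⟧ (address v) λ {x} x∈ x∈′ →
                            agree x∈ (subst (λ a → x ∈ reads ⟦ w ⟧ a) same x∈′))
                         (cong (reads ⟦ w ⟧) same)

-- Hard inputs

-- With s = r + 1 positive there is a copy `zero`, and `q₀` and `q₁` differ.
module LowerBounds (r : ℕ) where
  open Construction (suc r)
  open Indexed Pos↔Fin

  s : ℕ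
  s = suc r

  q₀ q₁ : Q
  q₀ = tabulate λ _ → false
  q₁ = tabulate λ _ → true

  _≟ⁱ_ : ∀ {n} → DecidableEquality (Input n)
  _≟ⁱ_ = Vec.≡-dec Bool._≟_

  _≟²_ : DecidableEquality (Q × Q)
  _≟²_ = Product.≡-dec _≟ⁱ_ _≟ⁱ_

  J-unique : Unique J
  J-unique = Unique.cartesianProduct⁺ (inputs-unique s) (inputs-unique s)

  f-vec⁺ : ∀ z a → Valid z a → f (vec z) ≡ true
  f-vec⁺ z a v = dec-true (valid? ⟦ vec z ⟧) (a , Valid-resp z ⟦ vec z ⟧ a (λ {x} _ → sym (⟦vec⟧ z x)) v)

  f-vec⁻ : ∀ z → (∀ a → ¬ Valid z a) → f (vec z) ≡ false
  f-vec⁻ z ¬v = dec-false (valid? ⟦ vec z ⟧) λ (a , v) →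
    ¬v a (Valid-resp ⟦ vec z ⟧ z a (λ {x} _ → ⟦vec⟧ z x) v)

  -- The hard 0-input

  blank : Assignment
  blank (cell _ b _ _ _)  = b
  blank (sheet _ _ _ _)   = false

  -- A fails because all m² ≥ m rows are slack, B because black cells are 1.
  ¬ValidAt-blank : ∀ ℓ b q → ¬ ValidAt blank ℓ b q
  ¬ValidAt-blank ℓ true (i , c , _) (short , _) = <⇒≱ short (≤-trans (m≤m*n m m {{m^n≢0 2 s}})
    (≤-reflexive (sym (trans (cong length (filter-all _ {J} (All.tabulate λ _ → refl))) length-J))))
  ¬ValidAt-blank ℓ false _ (_ , blacks) = contradiction (blacks q₀) λ ()

  f-blank : f (vec blank) ≡ false
  f-blank = f-vec⁻ blank λ a v → ¬ValidAt-blank zero (lookup a zero) (pointer blank a zero) (v zero)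

  2^t≡m³ : 2 ^ t ≡ m * m * m
  2^t≡m³ = trans (cong (2 ^_) (*-comm 3 s)) (trans (sym (^-*-assoc 2 s 3))
    (trans (cong (λ k → m * (m * k)) (*-identityʳ m)) (sym (*-assoc m m m))))

  -- The values at positions of the other kind are arbitrary: they can only make
  -- the pigeonhole arguments below less favourable.
  addressOf : Pos → Address
  addressOf (cell _ _ _ _ _)  = replicate t false
  addressOf (sheet a _ _ _)   = a

  columnOf : Pos → Q × Q
  columnOf (cell _ _ i _ c) = i , c
  columnOf (sheet _ _ _ _)  = q₀ , q₀

  rowOf : Pos → Q × Q
  rowOf (cell _ _ _ j _)  = j
  rowOf (sheet _ _ _ _)   = q₀ , q₀

  gapOf : Pos → (Q × Q) × Q
  gapOf (cell _ _ _ j c)  = j , c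
  gapOf (sheet _ _ _ _)   = (q₀ , q₀) , q₀

  -- Turns `blank` into a 1-input without changing the positions in `l`. The pigeonhole classes
  -- ignore the copy, so one column and one gap serve all copies at once.
  module Completion (l : List Pos) (l< : length l ℕ.< m * m * m) where
    abstract
      freeAddress : ∃[ a ] (∀ {x} → x ∈ l → addressOf x ≢ a)
      freeAddress = missed _≟ⁱ_ addressOf (inputs-unique t) l
        (subst (length l ℕ.<_) (sym (trans (length-inputs t) 2^t≡m³)) l<)

      freeColumn : ∃[ ic ] ic ∈ J × length (fibre _≟²_ columnOf ic l) ℕ.< m
      freeColumn = small-fibre _≟²_ columnOf m J-unique l (subst (λ k → length l ℕ.< k * m) (sym length-J) l<)

      freeGap : ∃[ jc ] (∀ {x} → x ∈ l → gapOf x ≢ jc)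
      freeGap = missed (Product.≡-dec _≟²_ _≟ⁱ_) gapOf (Unique.cartesianProduct⁺ J-unique (inputs-unique s)) l
        (subst (length l ℕ.<_) (sym (trans (length-cartesianProductWith _,_ J (inputs s))
                                         (cong₂ _*_ length-J (length-inputs s)))) l<)

    a : Address
    a = proj₁ freeAddress

    target : Bool → Q × Q × Q
    target true  = let (i , c) , _ = freeColumn in i , c , q₀
    target false = let ((j₁ , j₂) , c) , _ = freeGap in j₁ , j₂ , c

    component : Q × Q × Q → Fin 3 → Q
    component (u , _ , _) zero             = u
    component (_ , v , _) (suc zero)       = v
    component (_ , _ , w) (suc (suc zero)) = w

    -- Unread cells of copy ℓ take the bit a_ℓ: ones favour the A-certificate wanted there, zeros
    -- the B-certificate. The untouched sheet at `a` is filled with the targets.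
    completed : Assignment
    completed x@(cell ℓ b _ _ _) = if does (x ∈? l) then b else lookup a ℓ
    completed (sheet a′ ℓ i k)   =
      if does (a′ ≟ⁱ a) then lookup (component (target (lookup a ℓ)) i) k else false

    agrees : ∀ {x} → x ∈ l → completed x ≡ blank x
    agrees {x@(cell ℓ b _ _ _)} x∈l = cong (if_then b else lookup a ℓ) (dec-true (x ∈? l) x∈l)
    agrees {sheet a′ ℓ i k}     x∈l =
      cong (if_then lookup (component (target (lookup a ℓ)) i) k else false)
           (dec-false (a′ ≟ⁱ a) (proj₂ freeAddress x∈l))

    pointer≡ : ∀ ℓ → pointer completed a ℓ ≡ target (lookup a ℓ)
    pointer≡ ℓ = cong₂ _,_ (part zero) (cong₂ _,_ (part (suc zero)) (part (suc (suc zero))))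
      where
      part : ∀ i → component′ completed a ℓ i ≡ component (target (lookup a ℓ)) i
      part i = trans (tabulate-cong λ k → cong (if_then lookup (component (target (lookup a ℓ)) i) k else false)
                                               (dec-true (a ≟ⁱ a) refl))
                     (tabulate∘lookup (component (target (lookup a ℓ)) i))

    read-or-bit : ∀ {ℓ b i j c} (P : Bool → Set) → (cell ℓ b i j c ∈ l → P b) →
                  (cell ℓ b i j c ∉ l → P (lookup a ℓ)) → P (completed (cell ℓ b i j c))
    read-or-bit {ℓ} {b} {i} {j} {c} P inside outside with cell ℓ b i j c ∈? l
    ... | yes x∈ = inside x∈
    ... | no  x∉ = outside x∉

    -- For A, black cells are 1 whether read or not, and every white 0 of the column was read, so
    -- the slack embeds in a fibre of fewer than m positions. For B, white cells are 0 whether read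
    -- or not, and the black cells of the gap are unread.
    valid-at : ∀ ℓ b → lookup a ℓ ≡ b → ValidAt completed ℓ b (target b)
    valid-at ℓ true a≡ = short , λ j₁ j₂ c′ _ → read-or-bit (_≡ true) (λ _ → refl) (λ _ → a≡)
      where
      i = proj₁ (proj₁ freeColumn)
      c = proj₂ (proj₁ freeColumn)
      isFalse? : ∀ j → Dec (completed (cell ℓ white i j c) ≡ false)
      isFalse? j = completed (cell ℓ white i j c) Bool.≟ false
      read : ∀ {j} → j ∈ slack completed ℓ i c → cell ℓ white i j c ∈ l
      read {j} j∈ = read-or-bit {ℓ} {white} {i} {j} {c} (λ b → b ≡ false → cell ℓ white i j c ∈ l)
        (λ x∈ _ → x∈)
        (λ _ a≡false → contradiction (trans (sym a≡) a≡false) λ ())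
        (proj₂ (∈-filter⁻ isFalse? {xs = J} j∈))
      covered : ∀ {x} → x ∈ map (λ j → cell ℓ white i j c) (slack completed ℓ i c) →
                x ∈ fibre _≟²_ columnOf (i , c) l
      covered x∈ = let _ , j∈ , x≡ = ∈-map⁻ (λ j → cell ℓ white i j c) x∈ in
        subst (_∈ fibre _≟²_ columnOf (i , c) l) (sym x≡) (∈-filter⁺ (λ x → columnOf x ≟² (i , c)) (read j∈) refl)
      short : length (slack completed ℓ i c) ℕ.< m
      short = ≤-<-trans (≤-trans (≤-reflexive (sym (length-map (λ j → cell ℓ white i j c) (slack completed ℓ i c))))
        (Unique-length-≤ (Unique.map⁺ (λ { refl → refl }) (Unique.filter⁺ isFalse? J-unique)) covered))
        (proj₂ (proj₂ freeColumn))
    valid-at ℓ false a≡ =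
      (λ i c′ → read-or-bit (_≡ false) (λ _ → refl) (λ _ → a≡)) ,
      (λ i → read-or-bit (_≡ false) (λ x∈ → contradiction refl (proj₂ freeGap x∈)) (λ _ → a≡))

    valid : Valid completed a
    valid ℓ = subst (ValidAt completed ℓ (lookup a ℓ)) (sym (pointer≡ ℓ)) (valid-at ℓ (lookup a ℓ) refl)

  hard₀ : Hard f (vec blank) (m * m * m)
  hard₀ = hard λ l l< → let open Completion l l< in
    completed , agrees , λ eq → contradiction (trans (sym (f-vec⁺ completed a valid)) (trans eq f-blank)) λ ()

  -- The hard 1-input

  full : Assignment
  full (cell _ b _ _ _)  = not b
  full (sheet _ _ _ _)   = false

  f-full : f (vec full) ≡ true
  f-full = f-vec⁺ full (replicate t true) λ ℓ →
    subst (λ b → ValidAt full ℓ b (pointer full (replicate t true) ℓ)) (sym (lookup-replicate ℓ true))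
      (subst (λ xs → length xs ℕ.< m) (sym (filter-none _ {J} (All.tabulate λ _ ()))) (m^n>0 2 s) , λ _ _ _ ())

  -- All sheets are 0, so every address names only `q₀`. Clearing the white cell (`q₀`, j, `q₀`) of
  -- copy `zero` in an unread row j spoils A, since black cells are 0; B is spoiled by white ones at
  -- `q₁`.
  hard₁ : Hard f (vec full) (m * m)
  hard₁ = hard λ l l< →
    let j , j-free = missed _≟²_ rowOf J-unique l (subst (length l ℕ.<_) (sym length-J) l<)
    in flipped j , (λ x∈l → flipped-other j λ { refl → j-free x∈l refl }) ,
       λ eq → contradiction (trans (sym (trans eq f-full)) (f-vec⁻ (flipped j) λ a v →
         invalid j (lookup a zero) (subst (ValidAt (flipped j) zero (lookup a zero)) (pointer≡ j a) (v zero)))) λ ()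
    where
    centre : Q × Q → Pos
    centre j = cell zero white q₀ j q₀
    flipped : Q × Q → Assignment
    flipped j x = if does (x ≟ˣ centre j) then false else full x
    flipped-other : ∀ j {x} → x ≢ centre j → flipped j x ≡ full x
    flipped-other j {x} ne = cong (if_then false else full x) (dec-false (x ≟ˣ centre j) ne)
    pointer≡ : ∀ j a → pointer (flipped j) a zero ≡ (q₀ , q₀ , q₀)
    pointer≡ j a = cong₂ _,_ (part zero) (cong₂ _,_ (part (suc zero)) (part (suc (suc zero))))
      where
      part : ∀ i → component′ (flipped j) a zero i ≡ q₀
      part i = tabulate-cong λ k → flipped-other j {sheet a zero i k} λ ()
    invalid : ∀ j b → ¬ ValidAt (flipped j) zero b (q₀ , q₀ , q₀)
    invalid j true (_ , blacks) = contradiction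
      (trans (sym (blacks _ _ q₀ (cong (if_then false else true) (dec-true (centre j ≟ˣ centre j) refl))))
             (flipped-other j λ ())) λ ()
    invalid j false (whites , _) = contradiction
      (trans (sym (whites q₁ q₀)) (flipped-other j λ ())) λ ()

  f-nonConstant : ∃₂ λ x y → f x ≢ f y
  f-nonConstant = vec blank , vec full ,
    λ eq → contradiction (trans (sym f-blank) (trans eq f-full)) λ ()

  C≥ : m * m * m ≤ C f
  C≥ = Hard⇒≤C hard₀

  UCmin≥ : m * m ≤ UCmin f
  UCmin≥ = ⊓-glb
    (≤-trans (m≤m*n (m * m) m {{m^n≢0 2 s}}) (subst (λ b → m * m * m ≤ UC b f) f-blank (Hard⇒≤UC hard₀)))
    (subst (λ b → m * m ≤ UC b f) f-full (Hard⇒≤UC hard₁))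

-- Real exponents

numerator-* : ∀ x y → ↥ (x ℚ.* y) ≡ ↥ x ℤ.* ↥ y
numerator-* (mkℚᵘ _ _) (mkℚᵘ _ _) = refl

denominator-* : ∀ x y → ↧ₙ (x ℚ.* y) ≡ ↧ₙ x * ↧ₙ y
denominator-* (mkℚᵘ _ _) (mkℚᵘ _ _) = refl

numerator-^ : ∀ a b k → ↥ (mkℚᵘ (+ a) b ^ℚ k) ≡ + (a ^ k)
numerator-^ a b zero    = refl
numerator-^ a b (suc k) = trans (numerator-* (mkℚᵘ (+ a) b) (mkℚᵘ (+ a) b ^ℚ k))
  (trans (cong (+ a ℤ.*_) (numerator-^ a b k)) (sym (ℤ.pos-* a (a ^ k))))

denominator-^ : ∀ a b k → ↧ₙ (mkℚᵘ (+ a) b ^ℚ k) ≡ suc b ^ k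
denominator-^ a b zero    = refl
denominator-^ a b (suc k) = trans (denominator-* (mkℚᵘ (+ a) b) (mkℚᵘ (+ a) b ^ℚ k))
  (cong (suc b *_) (denominator-^ a b k))

-- Cross-multiplication reduces the cuts of `log₂` to inequalities between natural powers.
^-<⁻ : ∀ {a b k a′ b′ k′} → mkℚᵘ (+ a) b ^ℚ k ℚ.< mkℚᵘ (+ a′) b′ ^ℚ k′ →
       a ^ k * suc b′ ^ k′ ℕ.< a′ ^ k′ * suc b ^ k
^-<⁻ {a} {b} {k} {a′} {b′} {k′} lt = ℤ.drop‿+<+ (subst₂ ℤ._<_
  (cross a b k a′ b′ k′) (cross a′ b′ k′ a b k) (ℚ.drop-*<* lt))
  where
  cross : ∀ a b k a′ b′ k′ → ↥ (mkℚᵘ (+ a) b ^ℚ k) ℤ.* ↧ (mkℚᵘ (+ a′) b′ ^ℚ k′) ≡ + (a ^ k * suc b′ ^ k′)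
  cross a b k a′ b′ k′ = trans
    (cong₂ ℤ._*_ (numerator-^ a b k) (cong +_ (denominator-^ a′ b′ k′))) (sym (ℤ.pos-* (a ^ k) (suc b′ ^ k′)))

fromℕ-^ : ∀ k e → mkℚᵘ (+ (k ^ e)) 0 ≡ mkℚᵘ (+ k) 0 ^ℚ e
fromℕ-^ k e = sym (ℚ.↥↧≡⇒≡ (numerator-^ k 0 e) (trans (denominator-^ k 0 e) (^-zeroˡ e)))

0≤fromℕ : ∀ k → 0ℚᵘ ℚ.≤ mkℚᵘ (+ k) 0
0≤fromℕ k = *≤* (subst (+ 0 ℤ.≤_) (sym (ℤ.*-identityʳ (+ k))) (ℤ.+≤+ z≤n))

^ℚ-mono-≤ : ∀ {x y} .{{_ : ℚ.NonNegative x}} .{{_ : ℚ.NonNegative y}} → x ℚ.≤ y → ∀ k → x ^ℚ k ℚ.≤ y ^ℚ k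
^ℚ-mono-≤ x≤y zero = ℚ.≤-refl
^ℚ-mono-≤ {x} {y} x≤y (suc k) =
  ℚ.≤-trans (ℚ.*-monoʳ-≤-nonNeg x (^ℚ-mono-≤ x≤y k))
            (ℚ.*-monoˡ-≤-nonNeg (y ^ℚ k) {{^ℚ-nonNeg k}} x≤y)
  where
  ^ℚ-nonNeg : ∀ k → ℚ.NonNegative (y ^ℚ k)
  ^ℚ-nonNeg zero    = _
  ^ℚ-nonNeg (suc k) = ℚ.nonNeg*nonNeg⇒nonNeg y (y ^ℚ k) {{^ℚ-nonNeg k}}

^-distribʳ-* : ∀ k a b → (a * b) ^ k ≡ a ^ k * b ^ k
^-distribʳ-* zero    a b = refl
^-distribʳ-* (suc k) a b = trans (cong (a * b *_) (^-distribʳ-* k a b))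
  ([m*n]*[o*p]≡[m*o]*[n*p] a b (a ^ k) (b ^ k))

2^-cancel-< : ∀ {k l} → 2 ^ k ℕ.< 2 ^ l → k ℕ.< l
2^-cancel-< lt = ≰⇒> λ l≤k → <⇒≱ lt (^-monoʳ-≤ 2 l≤k)

*1^ : ∀ a k → a * 1 ^ k ≡ a
*1^ a k = trans (cong (a *_) (^-zeroˡ k)) (*-identityʳ a)

-- The cut condition reads 2^(3(d+1)) < 2^p. A negative numerator would put a power of 8 below a
-- power of ½.
3<upper-log₂8 : ∀ {σ} → Upper (log₂ (mkℚᵘ (+ 8) 0)) σ → ∃₂ λ p d → σ ≡ mkℚᵘ (+ p) d × 3 * suc d ℕ.< p
3<upper-log₂8 {mkℚᵘ (+ p) d} u = p , d , refl , 2^-cancel-<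
  (subst₂ ℕ._<_ (trans (*1^ (8 ^ suc d) p) (^-*-assoc 2 3 (suc d))) (*1^ (2 ^ p) (suc d))
    (^-<⁻ {8} {0} {suc d} {2} {0} {p} u))
3<upper-log₂8 {mkℚᵘ -[1+ p ] d} u = contradiction
  (subst (8 ^ suc d * 2 ^ suc p ℕ.<_) (trans (*1^ (1 ^ suc p) (suc d)) (^-zeroˡ (suc p)))
    (^-<⁻ {8} {0} {suc d} {1} {1} {suc p} u))
  (≤⇒≯ (*-mono-≤ (m^n>0 8 (suc d)) (m^n>0 2 (suc p))))

-- (38/3)⁴ < 2¹⁵
lower-log₂38/3<15/4 : ∀ p d → Lower (log₂ (mkℚᵘ (+ 38) 2)) (mkℚᵘ (+ p) d) → 4 * p ℕ.< 15 * suc d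
lower-log₂38/3<15/4 p d l = 2^-cancel-< (*-cancelʳ-< (81 ^ D) (2 ^ (4 * p)) (2 ^ (15 * D)) (begin-strict
  2 ^ (4 * p) * 81 ^ D       ≡⟨ cong₂ _*_ (cong (2 ^_) (*-comm 4 p)) (^-*-assoc 3 4 D) ⟩
  2 ^ (p * 4) * 3 ^ (4 * D)  ≡⟨ cong₂ _*_ (sym (^-*-assoc 2 p 4))
        (trans (cong (3 ^_) (*-comm 4 D)) (sym (^-*-assoc 3 D 4))) ⟩
  (2 ^ p) ^ 4 * (3 ^ D) ^ 4  ≡⟨ ^-distribʳ-* 4 (2 ^ p) (3 ^ D) ⟨
  (2 ^ p * 3 ^ D) ^ 4        <⟨ ^-monoˡ-< 4 base ⟩
  (38 ^ D) ^ 4               ≡⟨ ^-*-assoc 38 D 4 ⟩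
  38 ^ (D * 4)               ≡⟨ cong (38 ^_) (*-comm D 4) ⟩
  38 ^ (4 * D)               ≡⟨ ^-*-assoc 38 4 D ⟨
  (38 ^ 4) ^ D               ≤⟨ ^-monoˡ-≤ D (from-yes (38 ^ 4 ≤? 2 ^ 15 * 81)) ⟩
  (2 ^ 15 * 81) ^ D          ≡⟨ ^-distribʳ-* D (2 ^ 15) 81 ⟩
  (2 ^ 15) ^ D * 81 ^ D      ≡⟨ cong (_* 81 ^ D) (^-*-assoc 2 15 D) ⟩
  2 ^ (15 * D) * 81 ^ D      ∎))
  where
  open ≤-Reasoning
  D = suc d
  base : 2 ^ p * 3 ^ D ℕ.< 38 ^ D
  base = subst (2 ^ p * 3 ^ D ℕ.<_) (*1^ (38 ^ D) p) (^-<⁻ {2} {0} {p} {38} {2} {D} l)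

-- A point of the lower cut times some σ > 3 stays below some r < 15/4, and (15/4)/3 = 5/4.
exponent<5/4 : ∀ n e → Lower exponent (mkℚᵘ (+ n) e) → 4 * n ℕ.< 5 * suc e
exponent<5/4 n e (r , σ , lr , uσ , lt) with 3<upper-log₂8 {σ} uσ
exponent<5/4 n e (mkℚᵘ r d′ , _ , lr , _ , lt) | p , d , refl , 3d<p = go r lr
    (subst (ℤ._< r ℤ.* + (suc e * suc d)) np (ℚ.drop-*<* lt))
  where
  np : (+ n ℤ.* + p) ℤ.* + suc d′ ≡ + (n * p * suc d′)
  np = trans (cong (ℤ._* + suc d′) (sym (ℤ.pos-* n p))) (sym (ℤ.pos-* (n * p) (suc d′)))
  go : ∀ r → Lower (log₂ (mkℚᵘ (+ 38) 2)) (mkℚᵘ r d′) →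
       + (n * p * suc d′) ℤ.< r ℤ.* + (suc e * suc d) → 4 * n ℕ.< 5 * suc e
  go -[1+ _ ] _ ()
  go (+ p′) lr lt = *-cancelʳ-< (3 * (suc d * suc d′)) (4 * n) (5 * suc e) (begin-strict
    4 * n * (3 * (suc d * suc d′))      ≡⟨ rearrange₁ n (suc d) (suc d′) ⟩
    4 * (n * (3 * suc d) * suc d′)      ≤⟨ *-monoʳ-≤ 4 (*-monoˡ-≤ (suc d′) (*-monoʳ-≤ n (<⇒≤ 3d<p))) ⟩
    4 * (n * p * suc d′)                <⟨ *-monoʳ-< 4 drop-lt ⟩
    4 * (p′ * (suc e * suc d))          ≡⟨ *-assoc 4 p′ (suc e * suc d) ⟨
    4 * p′ * (suc e * suc d)            ≤⟨ *-monoˡ-≤ (suc e * suc d) (<⇒≤ (lower-log₂38/3<15/4 p′ d′ lr)) ⟩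
    15 * suc d′ * (suc e * suc d)       ≡⟨ rearrange₂ (suc e) (suc d) (suc d′) ⟩
    5 * suc e * (3 * (suc d * suc d′))  ∎)
    where
    open ≤-Reasoning
    drop-lt : n * p * suc d′ ℕ.< p′ * (suc e * suc d)
    drop-lt = ℤ.drop‿+<+ (subst (_ ℤ.<_) (sym (ℤ.pos-* p′ (suc e * suc d))) lt)
    rearrange₁ : ∀ n d d′ → 4 * n * (3 * (d * d′)) ≡ 4 * (n * (3 * d) * d′)
    rearrange₁ = solve-∀
    rearrange₂ : ∀ e d d′ → 15 * d′ * (e * d) ≡ 5 * e * (3 * (d * d′))
    rearrange₂ = solve-∀

-- 326/89 is a convergent of log₂ (38/3), and 1501/500 exceeds log₂ 8 = 3 by little
-- enough that still 1.22 · 1501/500 < 326/89.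
1·22<exponent : ∀ x → x ℚ.< + 122 / 100 → Lower exponent x
1·22<exponent x x< = mkℚᵘ (+ 326) 88 , mkℚᵘ (+ 1501) 499 ,
  from-yes (2^ (+ 326) ℚ.<? mkℚᵘ (+ 38) 2 ^ℚ 89) ,
  from-yes (mkℚᵘ (+ 8) 0 ^ℚ 500 ℚ.<? 2^ (+ 1501)) ,
  ℚ.<-trans (ℚ.*-monoˡ-<-pos (mkℚᵘ (+ 1501) 499) x<)
            (from-yes (+ 122 / 100 ℚ.* mkℚᵘ (+ 1501) 499 ℚ.<? mkℚᵘ (+ 326) 88))

-- Reduction of the asymptotic bounds to natural numbers

^^-exponent≥1·22 : ∀ B q → Lower (B ^^ fromℚ (+ 122 / 100)) q → Lower (B ^^ exponent) q
^^-exponent≥1·22 B q (n , e , n/e< , q<) = n , e , 1·22<exponent _ n/e< , q<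

Ω̃-bound≥Ω-bound : ∀ c B → Ω̃-bound c 0 exponent B ≥ℝ Ω-bound c (fromℚ (+ 122 / 100)) B
Ω̃-bound≥Ω-bound c B q (ρ , τ , (r , y , r<c , By , 0<y , ρ<) , τ>1 , qτ<ρ) =
  ρ , τ , (r , y , r<c , ^^-exponent≥1·22 B y By , 0<y , ρ<) , τ>1 , qτ<ρ

-- The hypothesis says that B^(5/4) ≤ D, and the exponent is below 5/4. Fourth powers keep the
-- comparison within the naturals.
^^-exponent≤ : ∀ {B D} → 1 ≤ B → B ^ 5 ≤ D ^ 4 → ∀ {y} → Lower (B ^^ exponent) y → y ℚ.< mkℚᵘ (+ D) 0
^^-exponent≤ {B} {D} 1≤B B⁵≤D⁴ {y} (n , e , lower , y^e<) = ℚ.≰⇒> λ D≤y → <⇒≱ (too-small D≤y) too-big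
  where
  instance _ = >-nonZero 1≤B
  too-small : mkℚᵘ (+ D) 0 ℚ.≤ y → D ^ suc e ℕ.< B ^ n
  too-small D≤y = ℤ.drop‿+<+ (subst₂ ℤ._<_ (ℤ.*-identityʳ _) (ℤ.*-identityʳ _) (ℚ.drop-*<*
    (ℚ.≤-<-trans (subst (ℚ._≤ y ^ℚ suc e) (sym (fromℕ-^ D (suc e)))
      (^ℚ-mono-≤ {{_}} {{ℚ.nonNegative (ℚ.≤-trans (0≤fromℕ D) D≤y)}} D≤y (suc e))) y^e<)))
  too-big : B ^ n ≤ D ^ suc e
  too-big = ≮⇒≥ λ lt → <⇒≱ (^-monoˡ-< 4 lt) (begin
    (B ^ n) ^ 4      ≡⟨ ^-*-assoc B n 4 ⟩
    B ^ (n * 4)      ≤⟨ ^-monoʳ-≤ B (subst (_≤ 5 * suc e) (*-comm 4 n) (<⇒≤ (exponent<5/4 n e lower))) ⟩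
    B ^ (5 * suc e)  ≡⟨ ^-*-assoc B 5 (suc e) ⟨
    (B ^ 5) ^ suc e  ≤⟨ ^-monoˡ-≤ (suc e) B⁵≤D⁴ ⟩
    (D ^ 4) ^ suc e  ≡⟨ ^-*-assoc D 4 (suc e) ⟩
    D ^ (4 * suc e)  ≡⟨ cong (D ^_) (*-comm 4 (suc e)) ⟩
    D ^ (suc e * 4)  ≡⟨ ^-*-assoc D (suc e) 4 ⟨
    (D ^ suc e) ^ 4  ∎)
    where open ≤-Reasoning

-- For k = 0 the denominator is 1, so its upper cut gives only τ > 1. The constant 1/(N+1) turns the
-- bound K(N+1) on the power of B into K.
≥Ω̃-bound : ∀ N {B K} → 1 ≤ B → B ^ 5 ≤ (K * suc N) ^ 4 → fromℕ K ≥ℝ Ω̃-bound (mkℚᵘ (+ 1) N) 0 exponent B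
≥Ω̃-bound N {B} {K} 1≤B B⁵≤ q (ρ , τ , (r , y , r<c , By , 0<y , ρ<ry) , 1<τ , qτ<ρ) = ℚ.≰⇒> λ K≤q →
  ℚ.<⇒≱ qτ<K (ℚ.≤-trans K≤q (ℚ.≤-trans (ℚ.≤-reflexive (ℚ.≃-sym (ℚ.*-identityʳ q)))
    (ℚ.*-monoʳ-≤-nonNeg q {{ℚ.nonNegative (ℚ.≤-trans (0≤fromℕ K) K≤q)}} (ℚ.<⇒≤ 1<τ))))
  where
  c k : ℚᵘ
  c = mkℚᵘ (+ 1) N
  k = mkℚᵘ (+ K) 0
  cD≤K : c ℚ.* mkℚᵘ (+ (K * suc N)) 0 ℚ.≤ k
  cD≤K = *≤* (ℤ.≤-reflexive (trans (ℤ.*-identityʳ _) (trans (ℤ.*-identityˡ _)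
    (trans (ℤ.pos-* K (suc N)) (cong (λ D → + K ℤ.* + D) (sym (*-identityʳ (suc N))))))))
  qτ<K : q ℚ.* τ ℚ.< k
  qτ<K = ℚ.<-trans qτ<ρ (ℚ.<-trans ρ<ry (ℚ.<-≤-trans
    (ℚ.<-trans (ℚ.*-monoˡ-<-pos y {{ℚ.positive 0<y}} r<c)
               (ℚ.*-monoʳ-<-pos c (^^-exponent≤ {D = K * suc N} 1≤B B⁵≤ {y} By))) cD≤K))

-- The family

n<2^n : ∀ n → n ℕ.< 2 ^ n
n<2^n zero    = s≤s z≤n
n<2^n (suc n) = ≤-trans (+-mono-≤ (m^n>0 2 n) (n<2^n n))
  (≤-reflexive (cong (λ k → 2 ^ n + k) (sym (+-identityʳ _))))

-- Strictness comes from the sheet bits; the cell count is compared only weakly.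
arity-mono : ∀ {s s′} → s ℕ.< s′ → Construction.arity s ℕ.< Construction.arity s′
arity-mono {s} {s′} s<s′ = +-mono-≤-<
  (*-mono-≤ t≤ (*-monoʳ-≤ 2 (*-mono-≤ m≤ (*-mono-≤ (*-mono-≤ m≤ m≤) m≤))))
  (≤-<-trans (*-monoˡ-≤ (3 * s * (3 * s)) (^-monoʳ-≤ 2 t≤))
               (*-monoʳ-< (2 ^ (3 * s′)) {{m^n≢0 2 (3 * s′)}} (*-mono-< t< t<)))
  where
  t< : 3 * s ℕ.< 3 * s′
  t< = *-monoʳ-< 3 s<s′
  t≤ = <⇒≤ t<
  m≤ : 2 ^ s ≤ 2 ^ s′
  m≤ = ^-monoʳ-≤ 2 (<⇒≤ s<s′)

^-split : ∀ e → e ^ 5 * e ^ 5 ≡ e ^ 10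
^-split e = sym (^-distribˡ-+-* e 5 5)

2^5u : ∀ u → 2 ^ (5 * u) ≡ (2 ^ u) ^ 5
2^5u u = trans (cong (2 ^_) (*-comm 5 u)) (sym (^-*-assoc 2 u 5))

-- With s = 5u the sum is at most 9sm² + 6sm² = 75um², and u ≤ e, m² = e¹⁰.
reads-bound : ∀ u m e → u ≤ e → 5 * u ≤ m * m → m ≡ e ^ 5 →
  3 * (5 * u) * (3 * (5 * u)) + 3 * (5 * u) * (m * m + m * m) ≤ 75 * e ^ 11
reads-bound u m e u≤e s≤m² m≡ = begin
  3 * s * (3 * s) + 3 * s * (m * m + m * m)
    ≤⟨ +-monoˡ-≤ _ (*-monoʳ-≤ (3 * s) (*-monoʳ-≤ 3 s≤m²)) ⟩
  3 * s * (3 * (m * m)) + 3 * s * (m * m + m * m)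
    ≡⟨ collect u (m * m) ⟩
  75 * (u * (m * m))          ≤⟨ *-monoʳ-≤ 75 (*-monoˡ-≤ (m * m) u≤e) ⟩
  75 * (e * (m * m))          ≡⟨ cong (λ k → 75 * (e * (k * k))) {m} {e ^ 5} m≡ ⟩
  75 * (e * (e ^ 5 * e ^ 5))  ≡⟨ cong (λ k → 75 * (e * k)) (^-split e) ⟩
  75 * e ^ 11                 ∎
  where
  open ≤-Reasoning
  s = 5 * u
  collect : ∀ u k → 3 * (5 * u) * (3 * k) + 3 * (5 * u) * (k + k) ≡ 75 * (u * k)
  collect = solve-∀

e¹⁵≡m³ : ∀ m e → m ≡ e ^ 5 → e ^ 15 ≡ m * m * m
e¹⁵≡m³ m e refl = trans (^-distribˡ-+-* e 10 5) (cong (_* e ^ 5) (sym (^-split e)))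

-- 5625 = 75².
gap : ∀ e {B K} → 1 ≤ e → B ≤ 75 * e ^ 11 → e ^ 15 ≤ K → B ^ 5 ≤ (K * 5625) ^ 4
gap e {B} {K} 1≤e B≤ ≤K = begin
  B ^ 5                    ≤⟨ ^-monoˡ-≤ 5 B≤ ⟩
  (75 * e ^ 11) ^ 5        ≡⟨ ^-distribʳ-* 5 75 (e ^ 11) ⟩
  75 ^ 5 * (e ^ 11) ^ 5    ≡⟨ cong (75 ^ 5 *_) (^-*-assoc e 11 5) ⟩
  -- The room between 11 · 5 and 15 · 4 is what pays for the factor s in `UCmin`.
  75 ^ 5 * e ^ 55          ≤⟨ *-mono-≤ (from-yes (75 ^ 5 ≤? 5625 ^ 4))
                                       (^-monoʳ-≤ e {{>-nonZero 1≤e}} (from-yes (55 ≤? 60))) ⟩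
  5625 ^ 4 * e ^ 60        ≡⟨ cong (5625 ^ 4 *_) (^-*-assoc e 15 4) ⟨
  5625 ^ 4 * (e ^ 15) ^ 4  ≤⟨ *-monoʳ-≤ (5625 ^ 4) (^-monoˡ-≤ 4 ≤K) ⟩
  5625 ^ 4 * K ^ 4         ≡⟨ *-comm (5625 ^ 4) (K ^ 4) ⟩
  K ^ 4 * 5625 ^ 4         ≡⟨ ^-distribʳ-* 4 K 5625 ⟨
  (K * 5625) ^ 4           ∎
  where open ≤-Reasoning

-- Taking s = 5u makes m the fifth power of e = 2ᵘ, so that s ≤ 5e costs only a fifth
-- root of m: UCmin ≤ 75 e¹¹ and C ≥ e¹⁵.
module Member (i : ℕ) where
  r e : ℕ
  -- Chosen so that `suc r` computes to `5 * suc i`, that is, s = 5u with u = i + 1.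
  r = i + 4 * suc i
  e = 2 ^ suc i

  open Construction (suc r) using (m; f; arity; UC₁≤) public
  open LowerBounds r using (C≥; UCmin≥; f-nonConstant) public

  abstract
    m≤m² : m ≤ m * m
    m≤m² = m≤m*n m m {{m^n≢0 2 (suc r)}}

    UCmin> : i ℕ.< UCmin f
    UCmin> = ≤-trans (≤-trans (≤-trans (s≤s (m≤m+n i (4 * suc i))) (<⇒≤ (n<2^n (suc r)))) m≤m²) UCmin≥

    UCmin⁵≤ : UCmin f ^ 5 ≤ (C f * 5625) ^ 4
    UCmin⁵≤ = gap e (m^n>0 2 (suc i))
      (≤-trans (≤-trans (m⊓n≤n (UC false f) (UC true f)) UC₁≤)
        (reads-bound (suc i) m e (<⇒≤ (n<2^n (suc i))) (≤-trans (<⇒≤ (n<2^n (suc r))) m≤m²) (2^5u (suc i))))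
      (≤-trans (≤-reflexive (e¹⁵≡m³ m e (2^5u (suc i)))) C≥)

family : Family
family = record
  { arity            = λ i → Member.arity i
  ; arity-increasing = λ i → arity-mono (*-monoʳ-< 5 (n<1+n (suc i)))
  ; fun              = λ i → Member.f i
  ; nonConstant      = λ i → Member.f-nonConstant i
  ; UCmin→∞          = λ k → k , λ i k≤i → ≤-trans k≤i (<⇒≤ (Member.UCmin> i))
  }

theorem5 :
    Σ[ F ∈ Family ] ∃[ c ] ∃[ k ] ∃[ c′ ]
      0ℚᵘ < c × 0ℚᵘ < c′ ×
      (∀ i → let f = Family.fun F i
                 B = UCmin f
             in (fromℕ (C f) ≥ℝ Ω̃-bound c k exponent B)
              × (Ω̃-bound c k exponent B ≥ℝ Ω-bound c′ (fromℚ (+ 122 / 100)) B))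
theorem5 = family , c , 0 , c , 0<c , 0<c , λ i →
    ≥Ω̃-bound 5624 (≤-trans (s≤s z≤n) (Member.UCmin> i)) (Member.UCmin⁵≤ i) ,
    Ω̃-bound≥Ω-bound c (UCmin (Member.f i))
  where
  c : ℚᵘ
  -- `mkℚᵘ` stores the denominator less one: this is 1/5625, matching the constant in `gap`.
  c = mkℚᵘ (+ 1) 5624
  0<c : 0ℚᵘ < c
  0<c = from-yes (0ℚᵘ ℚ.<? c)
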